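{- Let $n_1\in\mathbb{Z}_{\ge0}$, $n_2\in\mathbb{Z}_{\ge1}$, let $\ell$ be a prime number, and let $t=\ell^{n_1+1}+\ell^{n_1}$. For the bouquet $X_t$ consisting of $t$ loops there is a vector $\alpha\in\mathbb{Z}_\ell^t\setminus(\ell\mathbb{Z}_\ell)^t$ (depending on both $n_1$ and $n_2$) such that the associated Iwasawa invariants satisfy $$\mu_\ell(X_t,\alpha)=n_1,\qquad \lambda_\ell(X_t,\alpha)=2\ell^{n_2}-1.$$
   Context: For $b\in\mathbb{Z}_\ell$ put $\binom{b}{n}=\frac{b(b-1)\cdots(b-n+1)}{n!}\in\mathbb{Z}_\ell$ and $(1+T)^b=\sum_{n\ge0}\binom{b}{n}T^n\in\mathbb{Z}_\ell[[T]]$. The bouquet $X_t$ is the multigraph with one vertex and $t$ undirected loops; a vector $\alpha=(\alpha_1,\dots,\alpha_t)\in\mathbb{Z}_\ell^t$ assigns the voltage $\alpha_j$ to the $j$-th loop. It is admissible if $\alpha\in\mathbb{Z}_\ell^t\setminus(\ell\mathbb{Z}_\ell)^t$. The characteristic series is $$f(T)=f_{X_t,\alpha}(T)=\sum_{j=1}^t\big(2-(1+T)^{\alpha_j}-(1+T)^{ -\alpha_j}\big)\in\mathbb{Z}_\ell[[T]].$$ For admissible $\alpha$ it is nonzero, and it has zero constant term. By Weierstrass preparation write $f(T)=\ell^{\mu}g(T)u(T)$ with $\mu\in\mathbb{Z}_{\ge0}$, $g$ a distinguished polynomial (monic, all non-leading coefficients divisible by $\ell$) and $u\in\mathbb{Z}_\ell[[T]]^\times$.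 Then $\mu_\ell(X_t,\alpha):=\mu$ and $\lambda_\ell(X_t,\alpha):=\deg g-1$ (note the shift by $-1$). -}

module Defs where

open import Algebra.Bundles using (CommutativeRing; RawRing)
import Algebra.Definitions as AlgebraDefinitions
import Algebra.Definitions.RawMagma as RawMagmaDefinitions
import Algebra.Definitions.RawMonoid as RawMonoidDefinitions
open import Data.Fin.Base using (toℕ)
open import Data.Integer.Base as ℤ using (ℤ; +_; -[1+_]; 0ℤ; 1ℤ)
import Data.Integer.Properties as ℤ
open import Data.Integer.Divisibility.Signed
  using (_∣_; divides; quotient; ∣ᵤ⇒∣; ∣⇒∣ᵤ; ∣-trans; ∣m∣n⇒∣m+n; ∣m∣n⇒∣m-n;
         ∣m⇒∣-m; ∣m⇒∣m*n; ∣n⇒∣m*n)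
open import Data.Integer.Tactic.RingSolver using (solve-∀)
open import Data.Nat.Base as ℕ using (ℕ; zero; suc; _^_; _!; _∸_; NonZero; _<_; _≤_)
import Data.Nat.Properties as ℕ
import Data.Nat.Divisibility as ℕ∣
open import Data.Nat.Induction using (<-wellFounded)
open import Data.Nat.Primality using (Prime; euclidsLemma; prime⇒nonZero; prime⇒nonTrivial)
open import Data.Product.Base using (_,_)
open import Data.Sum.Base using (inj₁; inj₂)
open import Data.Vec.Functional using (Vector)
open import Induction.WellFounded using (Acc; acc)
open import Level using (0ℓ)
open import Relation.Binary.PropositionalEquality
  using (_≡_; refl; sym; trans; cong; cong₂; subst; subst₂)
open import Relation.Nullary using (¬_; yes; no; contradiction)

fallingℤ : ℤ → ℕ → ℤ
fallingℤ z zero    = 1ℤ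
fallingℤ z (suc n) = fallingℤ z n ℤ.* (z ℤ.- + n)

private
  falling-head : ∀ z n → fallingℤ (1ℤ ℤ.+ z) (suc n) ≡ (1ℤ ℤ.+ z) ℤ.* fallingℤ z n
  falling-head z zero    = lemma z
    where
    lemma : ∀ z → 1ℤ ℤ.* ((1ℤ ℤ.+ z) ℤ.- 0ℤ) ≡ (1ℤ ℤ.+ z) ℤ.* 1ℤ
    lemma = solve-∀
  falling-head z (suc n) =
    trans (cong (ℤ._* ((1ℤ ℤ.+ z) ℤ.- (1ℤ ℤ.+ + n))) (falling-head z n))
          (lemma z (fallingℤ z n) (+ n))
    where
    lemma : ∀ z f m → (1ℤ ℤ.+ z) ℤ.* f ℤ.* ((1ℤ ℤ.+ z) ℤ.- (1ℤ ℤ.+ m))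
                    ≡ (1ℤ ℤ.+ z) ℤ.* (f ℤ.* (z ℤ.- m))
    lemma = solve-∀

  falling-step : ∀ z n → fallingℤ (1ℤ ℤ.+ z) (suc n)
                       ≡ fallingℤ z (suc n) ℤ.+ + suc n ℤ.* fallingℤ z n
  falling-step z n = trans (falling-head z n) (lemma z (fallingℤ z n) (+ n))
    where
    lemma : ∀ z f m → (1ℤ ℤ.+ z) ℤ.* f ≡ f ℤ.* (z ℤ.- m) ℤ.+ (1ℤ ℤ.+ m) ℤ.* f
    lemma = solve-∀

  falling-0 : ∀ n → fallingℤ 0ℤ (suc n) ≡ 0ℤ
  falling-0 zero    = refl
  falling-0 (suc n) = cong (ℤ._* (0ℤ ℤ.- + suc n)) (falling-0 n)

  *-mono-∣ : ∀ {i j} k → i ∣ j → k ℤ.* i ∣ k ℤ.* j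
  *-mono-∣ {i} k (divides q refl) = divides q (lemma k q i)
    where
    lemma : ∀ k q i → k ℤ.* (q ℤ.* i) ≡ q ℤ.* (k ℤ.* i)
    lemma = solve-∀

abstract
  n!∣fallingℤ : ∀ n z → + (n !) ∣ fallingℤ z n
  n!∣fallingℤ zero    z = divides 1ℤ refl
  n!∣fallingℤ (suc n) = go
    where
    F G : ℤ → ℤ
    F z = fallingℤ z (suc n)
    G z = + suc n ℤ.* fallingℤ z n

    step : ∀ z → + (suc n !) ∣ G z
    step z = subst (_∣ G z) (sym (ℤ.pos-* (suc n) (n !))) (*-mono-∣ (+ suc n) (n!∣fallingℤ n z))

    up : ∀ z → + (suc n !) ∣ F z → + (suc n !) ∣ F (1ℤ ℤ.+ z)
    up z d = subst (_ ∣_) (sym (falling-step z n)) (∣m∣n⇒∣m+n d (step z))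

    down : ∀ z → + (suc n !) ∣ F (1ℤ ℤ.+ z) → + (suc n !) ∣ F z
    down z d = subst (_ ∣_) eq (∣m∣n⇒∣m-n d (step z))
      where
      lemma : ∀ a b → (a ℤ.+ b) ℤ.- b ≡ a
      lemma = solve-∀
      eq : F (1ℤ ℤ.+ z) ℤ.- G z ≡ F z
      eq = trans (cong (ℤ._- G z) (falling-step z n)) (lemma (F z) (G z))

    at-0 : + (suc n !) ∣ F 0ℤ
    at-0 = divides 0ℤ (falling-0 n)

    go : ∀ z → + (suc n !) ∣ F z
    go (+ zero)       = at-0
    go (+ suc m)      = up (+ m) (go (+ m))
    go -[1+ zero ]    = down -[1+ zero ] at-0
    go -[1+ suc m ]   = down -[1+ suc m ] (go -[1+ m ])

binomialℤ : ℤ → ℕ → ℤ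
binomialℤ z n = quotient (n!∣fallingℤ n z)

binomialℤ-spec : ∀ z n → + (n !) ℤ.* binomialℤ z n ≡ fallingℤ z n
binomialℤ-spec z n =
  trans (ℤ.*-comm (+ (n !)) (binomialℤ z n)) (sym (_∣_.equality (n!∣fallingℤ n z)))

abstract
  +-cong-∣ : ∀ {m} a b c d → m ∣ a ℤ.- b → m ∣ c ℤ.- d → m ∣ (a ℤ.+ c) ℤ.- (b ℤ.+ d)
  +-cong-∣ a b c d p q = subst (_ ∣_) (lemma a b c d) (∣m∣n⇒∣m+n p q)
    where
    lemma : ∀ a b c d → (a ℤ.- b) ℤ.+ (c ℤ.- d) ≡ (a ℤ.+ c) ℤ.- (b ℤ.+ d)
    lemma = solve-∀

  *-cong-∣ : ∀ {m} a b c d → m ∣ a ℤ.- b → m ∣ c ℤ.- d → m ∣ (a ℤ.* c) ℤ.- (b ℤ.* d)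
  *-cong-∣ a b c d p q =
    subst (_ ∣_) (lemma a b c d) (∣m∣n⇒∣m+n (∣m⇒∣m*n c p) (∣n⇒∣m*n b q))
    where
    lemma : ∀ a b c d → (a ℤ.- b) ℤ.* c ℤ.+ b ℤ.* (c ℤ.- d) ≡ (a ℤ.* c) ℤ.- (b ℤ.* d)
    lemma = solve-∀

  neg-cong-∣ : ∀ {m} a b → m ∣ a ℤ.- b → m ∣ (ℤ.- a) ℤ.- (ℤ.- b)
  neg-cong-∣ a b p = subst (_ ∣_) (lemma a b) (∣m⇒∣-m p)
    where
    lemma : ∀ a b → ℤ.- (a ℤ.- b) ≡ (ℤ.- a) ℤ.- (ℤ.- b)
    lemma = solve-∀

  refl-∣ : ∀ {m} a b → a ≡ b → m ∣ a ℤ.- b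
  refl-∣ a .a refl = divides 0ℤ (ℤ.+-inverseʳ a)

  sym-∣ : ∀ {m} a b → m ∣ a ℤ.- b → m ∣ b ℤ.- a
  sym-∣ a b p = subst (_ ∣_) (lemma a b) (∣m⇒∣-m p)
    where
    lemma : ∀ a b → ℤ.- (a ℤ.- b) ≡ b ℤ.- a
    lemma = solve-∀

  trans-∣ : ∀ {m} a b c → m ∣ a ℤ.- b → m ∣ b ℤ.- c → m ∣ a ℤ.- c
  trans-∣ a b c p q = subst (_ ∣_) (lemma a b c) (∣m∣n⇒∣m+n p q)
    where
    lemma : ∀ a b c → (a ℤ.- b) ℤ.+ (b ℤ.- c) ≡ a ℤ.- c
    lemma = solve-∀

  ^-mono-∣ : ∀ m {j k} → j ≤ k → m ^ j ℕ∣.∣ m ^ k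
  ^-mono-∣ m {j} {k} j≤k = ℕ∣.divides (m ^ (k ∸ j))
    (trans (cong (m ^_) (sym (ℕ.m∸n+n≡m j≤k))) (ℕ.^-distribˡ-+-* m (k ∸ j) j))

  falling-cong-∣ : ∀ {m} a b n → m ∣ a ℤ.- b → m ∣ fallingℤ a n ℤ.- fallingℤ b n
  falling-cong-∣ a b zero    p = refl-∣ 1ℤ 1ℤ refl
  falling-cong-∣ a b (suc n) p =
    *-cong-∣ (fallingℤ a n) (fallingℤ b n) (a ℤ.- + n) (b ℤ.- + n)
      (falling-cong-∣ a b n p)
      (+-cong-∣ a b (ℤ.- + n) (ℤ.- + n) p (refl-∣ (ℤ.- + n) (ℤ.- + n) refl))

-- ℤ_ℓ = lim ℤ/ℓᵏ: the class of x in ℤ/ℓᵏ is that of approx x k, so two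
-- coherent sequences denote the same ℓ-adic integer when they are related
-- by _≈ₐ_ below.  Without eta, conversion checking never compares the
-- coherence proofs.
record Adic (ℓ : ℕ) : Set where
  no-eta-equality
  constructor mkAdic
  field
    approx   : ℕ → ℤ
    coherent : ∀ k → + (ℓ ^ k) ∣ approx (suc k) ℤ.- approx k

open Adic public

module _ (ℓ : ℕ) where

  infix 4 _≈ₐ_
  record _≈ₐ_ (x y : Adic ℓ) : Set where
    constructor mk≈
    field
      residue : ∀ k → + (ℓ ^ k) ∣ approx x k ℤ.- approx y k

  open _≈ₐ_ public

  fromℤ : ℤ → Adic ℓ
  fromℤ z = mkAdic (λ _ → z) (λ _ → refl-∣ z z refl)

  private
    _+ₐ_ _*ₐ_ : Adic ℓ → Adic ℓ → Adic ℓ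
    x +ₐ y = mkAdic (λ k → approx x k ℤ.+ approx y k) λ k →
      +-cong-∣ (approx x (suc k)) (approx x k) (approx y (suc k)) (approx y k)
        (coherent x k) (coherent y k)
    x *ₐ y = mkAdic (λ k → approx x k ℤ.* approx y k) λ k →
      *-cong-∣ (approx x (suc k)) (approx x k) (approx y (suc k)) (approx y k)
        (coherent x k) (coherent y k)

    -ₐ_ : Adic ℓ → Adic ℓ
    -ₐ x = mkAdic (λ k → ℤ.- approx x k) λ k →
      neg-cong-∣ (approx x (suc k)) (approx x k) (coherent x k)

    pointwise : ∀ {x y} → (∀ k → approx x k ≡ approx y k) → x ≈ₐ y
    pointwise {x} {y} eq = mk≈ λ k → refl-∣ (approx x k) (approx y k) (eq k)

  adicRing : CommutativeRing 0ℓ 0ℓ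
  adicRing = record
    { Carrier = Adic ℓ
    ; _≈_ = _≈ₐ_
    ; _+_ = _+ₐ_
    ; _*_ = _*ₐ_
    ; -_  = -ₐ_
    ; 0#  = fromℤ 0ℤ
    ; 1#  = fromℤ 1ℤ
    ; isCommutativeRing = record
      { isRing = record
        { +-isAbelianGroup = record
          { isGroup = record
            { isMonoid = record
              { isSemigroup = record
                { isMagma = record
                  { isEquivalence = record
                    { refl  = pointwise λ _ → refl
                    ; sym   = λ {x} {y} p → mk≈ λ k →
                        sym-∣ (approx x k) (approx y k) (residue p k)
                    ; trans = λ {x} {y} {z} p q → mk≈ λ k →
                        trans-∣ (approx x k) (approx y k) (approx z k) (residue p k) (residue q k)
                    }
                  ; ∙-cong = λ {x} {y} {u} {v} p q → mk≈ λ k →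
                      +-cong-∣ (approx x k) (approx y k) (approx u k) (approx v k)
                        (residue p k) (residue q k)
                  }
                ; assoc = λ x y z → pointwise λ k →
                    ℤ.+-assoc (approx x k) (approx y k) (approx z k)
                }
              ; identity = (λ x → pointwise λ k → ℤ.+-identityˡ (approx x k))
                         , (λ x → pointwise λ k → ℤ.+-identityʳ (approx x k))
              }
            ; inverse = (λ x → pointwise λ k → ℤ.+-inverseˡ (approx x k))
                      , (λ x → pointwise λ k → ℤ.+-inverseʳ (approx x k))
            ; ⁻¹-cong = λ {x} {y} p → mk≈ λ k →
                neg-cong-∣ (approx x k) (approx y k) (residue p k)
            }
          ; comm = λ x y → pointwise λ k → ℤ.+-comm (approx x k) (approx y k)
          }
        ; *-cong = λ {x} {y} {u} {v} p q → mk≈ λ k →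
            *-cong-∣ (approx x k) (approx y k) (approx u k) (approx v k)
              (residue p k) (residue q k)
        ; *-assoc = λ x y z → pointwise λ k →
            ℤ.*-assoc (approx x k) (approx y k) (approx z k)
        ; *-identity = (λ x → pointwise λ k → ℤ.*-identityˡ (approx x k))
                     , (λ x → pointwise λ k → ℤ.*-identityʳ (approx x k))
        ; distrib = (λ x y z → pointwise λ k →
                       ℤ.*-distribˡ-+ (approx x k) (approx y k) (approx z k))
                  , (λ x y z → pointwise λ k →
                       ℤ.*-distribʳ-+ (approx x k) (approx y k) (approx z k))
        }
      ; *-comm = λ x y → pointwise λ k → ℤ.*-comm (approx x k) (approx y k)
      }
    }

  private
    module ℤₗ = CommutativeRing adicRing

  falling : Adic ℓ → ℕ → Adic ℓ
  falling b zero    = ℤₗ.1#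
  falling b (suc n) = falling b n ℤₗ.* (b ℤₗ.- fromℤ (+ n))

  approx-falling : ∀ b n k → approx (falling b n) k ≡ fallingℤ (approx b k) n
  approx-falling b zero    k = refl
  approx-falling b (suc n) k = cong (ℤ._* (approx b k ℤ.- + n)) (approx-falling b n k)

  coherent-+ : ∀ b k m → + (ℓ ^ k) ∣ approx b (m ℕ.+ k) ℤ.- approx b k
  coherent-+ b k zero    = refl-∣ (approx b k) (approx b k) refl
  coherent-+ b k (suc m) =
    trans-∣ (approx b (suc m ℕ.+ k)) (approx b (m ℕ.+ k)) (approx b k)
      (∣-trans (∣ᵤ⇒∣ (^-mono-∣ ℓ (ℕ.m≤n+m k m))) (coherent b (m ℕ.+ k)))
      (coherent-+ b k m)

module _ (ℓ : ℕ) (ℓ-prime : Prime ℓ) where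

  private
    instance
      ℓ≢0 : NonZero ℓ
      ℓ≢0 = prime⇒nonZero ℓ-prime

    cancel-coprime : ∀ k m D → ¬ (ℓ ℕ∣.∣ m) → ℓ ^ k ℕ∣.∣ m ℕ.* D → ℓ ^ k ℕ∣.∣ D
    cancel-coprime zero    m D ℓ∤m h = ℕ∣.1∣ D
    cancel-coprime (suc k) m D ℓ∤m h
      with euclidsLemma m D ℓ-prime (ℕ∣.∣-trans (ℕ∣.m∣m*n (ℓ ^ k)) h)
    ... | inj₁ ℓ∣m = contradiction ℓ∣m ℓ∤m
    ... | inj₂ (ℕ∣.divides q refl) =
      subst (ℓ ^ suc k ℕ∣.∣_) (ℕ.*-comm ℓ q)
        (ℕ∣.*-monoʳ-∣ ℓ (cancel-coprime k m q ℓ∤m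
          (ℕ∣.*-cancelˡ-∣ ℓ (subst (ℓ ^ suc k ℕ∣.∣_) eq h))))
      where
      eq : m ℕ.* (q ℕ.* ℓ) ≡ ℓ ℕ.* (m ℕ.* q)
      eq = trans (sym (ℕ.*-assoc m q ℓ)) (ℕ.*-comm (m ℕ.* q) ℓ)

    cancel : ∀ k m → .{{NonZero m}} → Acc _<_ m → ∀ D →
             ℓ ^ (m ℕ.+ k) ℕ∣.∣ m ℕ.* D → ℓ ^ k ℕ∣.∣ D
    cancel k m (acc rs) D h with ℓ ℕ∣.∣? m
    ... | no ℓ∤m =
      ℕ∣.∣-trans (^-mono-∣ ℓ (ℕ.m≤n+m k m)) (cancel-coprime (m ℕ.+ k) m D ℓ∤m h)
    ... | yes (ℕ∣.divides (suc q) refl) =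
      cancel k (suc q) (rs q<m) D
        (ℕ∣.*-cancelˡ-∣ ℓ (subst (ℓ ^ suc (suc q ℕ.+ k) ℕ∣.∣_) eq
          (ℕ∣.∣-trans (^-mono-∣ ℓ (ℕ.+-monoˡ-≤ k q<m)) h)))
      where
      q<m : suc q < suc q ℕ.* ℓ
      q<m = ℕ.m<m*n (suc q) ℓ (ℕ.nonTrivial⇒n>1 ℓ {{prime⇒nonTrivial ℓ-prime}})
      eq : suc q ℕ.* ℓ ℕ.* D ≡ ℓ ℕ.* (suc q ℕ.* D)
      eq = trans (cong (ℕ._* D) (ℕ.*-comm (suc q) ℓ)) (ℕ.*-assoc ℓ (suc q) D)

    cancelℤ : ∀ k m → .{{NonZero m}} → ∀ z →
              + (ℓ ^ (m ℕ.+ k)) ∣ + m ℤ.* z → + (ℓ ^ k) ∣ z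
    cancelℤ k m z h = ∣ᵤ⇒∣
      (cancel k m (<-wellFounded m) ℤ.∣ z ∣
        (subst (ℓ ^ (m ℕ.+ k) ℕ∣.∣_) (ℤ.abs-* (+ m) z) (∣⇒∣ᵤ h)))

  -- Division by n! loses at most n! powers of ℓ, so the residue of
  -- b(b-1)⋯(b-n+1)/n! modulo ℓᵏ is read off from b modulo ℓ^(n! + k).
  -- See binomial-spec and binomial-unique.
  binomial : Adic ℓ → ℕ → Adic ℓ
  binomial b n = mkAdic (λ k → binomialℤ (b′ k) n) λ k →
    cancelℤ k (n !) {{n ℕ.!≢0}} (binomialℤ (b′ (suc k)) n ℤ.- binomialℤ (b′ k) n)
      (subst (_ ∣_) (eq k)
        (falling-cong-∣ (b′ (suc k)) (b′ k) n
          (subst (λ j → + (ℓ ^ (n ! ℕ.+ k)) ∣ approx b j ℤ.- b′ k)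
            (sym (ℕ.+-suc (n !) k)) (coherent b (n ! ℕ.+ k)))))
    where
    b′ : ℕ → ℤ
    b′ k = approx b (n ! ℕ.+ k)

    eq : ∀ k → fallingℤ (b′ (suc k)) n ℤ.- fallingℤ (b′ k) n
             ≡ + (n !) ℤ.* (binomialℤ (b′ (suc k)) n ℤ.- binomialℤ (b′ k) n)
    eq k = trans
      (cong₂ ℤ._-_ (sym (binomialℤ-spec (b′ (suc k)) n)) (sym (binomialℤ-spec (b′ k) n)))
      (lemma (+ (n !)) (binomialℤ (b′ (suc k)) n) (binomialℤ (b′ k) n))
      where
      lemma : ∀ m x y → m ℤ.* x ℤ.- m ℤ.* y ≡ m ℤ.* (x ℤ.- y)
      lemma = solve-∀

  private
    module ℤₗ = CommutativeRing (adicRing ℓ)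

  binomial-spec : ∀ b n → fromℤ ℓ (+ (n !)) ℤₗ.* binomial b n ℤₗ.≈ falling ℓ b n
  binomial-spec b n = mk≈ λ k →
    subst₂ (λ x y → + (ℓ ^ k) ∣ x ℤ.- y)
      (sym (binomialℤ-spec (approx b (n ! ℕ.+ k)) n))
      (sym (approx-falling ℓ b n k))
      (falling-cong-∣ (approx b (n ! ℕ.+ k)) (approx b k) n (coherent-+ ℓ b k (n !)))

  binomial-unique : ∀ b n c → fromℤ ℓ (+ (n !)) ℤₗ.* c ℤₗ.≈ falling ℓ b n →
                    c ℤₗ.≈ binomial b n
  binomial-unique b n c p = mk≈ λ k →
    trans-∣ (approx c k) (approx c (n ! ℕ.+ k)) (approx d k)
      (sym-∣ (approx c (n ! ℕ.+ k)) (approx c k) (coherent-+ ℓ c k (n !)))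
      (trans-∣ (approx c (n ! ℕ.+ k)) (approx d (n ! ℕ.+ k)) (approx d k)
        (cancelℤ k (n !) {{n ℕ.!≢0}} (approx c (n ! ℕ.+ k) ℤ.- approx d (n ! ℕ.+ k))
          (subst (_ ∣_) (lemma (+ (n !)) (approx c (n ! ℕ.+ k)) (approx d (n ! ℕ.+ k)))
            (residue (ℤₗ.trans p (ℤₗ.sym (binomial-spec b n))) (n ! ℕ.+ k))))
        (coherent-+ ℓ d k (n !)))
    where
    d = binomial b n
    lemma : ∀ m x y → m ℤ.* x ℤ.- m ℤ.* y ≡ m ℤ.* (x ℤ.- y)
    lemma = solve-∀

module _ {c r} (R : CommutativeRing c r) where

  private
    module R = CommutativeRing R
  open RawMonoidDefinitions R.+-rawMonoid using (sum)

  seriesRing : RawRing c r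
  seriesRing = record
    { Carrier = ℕ → R.Carrier
    ; _≈_ = λ f g → ∀ n → f n R.≈ g n
    ; _+_ = λ f g n → f n R.+ g n
    ; _*_ = λ f g n → sum {suc n} λ i → f (toℕ i) R.* g (n ∸ toℕ i)
    ; -_  = λ f n → R.- f n
    ; 0#  = λ _ → R.0#
    ; 1#  = λ { zero → R.1# ; (suc _) → R.0# }
    }

  scale : R.Carrier → RawRing.Carrier seriesRing → RawRing.Carrier seriesRing
  scale a f n = a R.* f n

module _ (ℓ : ℕ) where

  private
    module ℤₗ = CommutativeRing (adicRing ℓ)
    module ℤₗ⟦T⟧ = RawRing (seriesRing (adicRing ℓ))
  open RawMagmaDefinitions ℤₗ.*-rawMagma using () renaming (_∣_ to _∣ₐ_)

  -- The bouquet with t loops has one vertex, so a voltage assignment is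
  -- just a t-tuple indexed by the loops.
  Voltage : ℕ → Set
  Voltage t = Vector (Adic ℓ) t

  Admissible : ∀ {t} → Voltage t → Set
  Admissible α = ¬ (∀ j → fromℤ ℓ (+ ℓ) ∣ₐ α j)

  record IsDistinguished (g : ℤₗ⟦T⟧.Carrier) (d : ℕ) : Set where
    field
      monic  : g d ℤₗ.≈ ℤₗ.1#
      lower  : ∀ i → i < d → fromℤ ℓ (+ ℓ) ∣ₐ g i
      degree : ∀ i → d < i → g i ℤₗ.≈ ℤₗ.0#

  IsUnit : ℤₗ⟦T⟧.Carrier → Set
  IsUnit = AlgebraDefinitions.Invertible ℤₗ⟦T⟧._≈_ ℤₗ⟦T⟧.1# ℤₗ⟦T⟧._*_

module _ (ℓ : ℕ) (ℓ-prime : Prime ℓ) where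

  private
    module ℤₗ = CommutativeRing (adicRing ℓ)
    module ℤₗ⟦T⟧ = RawRing (seriesRing (adicRing ℓ))
  open RawMonoidDefinitions ℤₗ⟦T⟧.+-rawMonoid using (sum)

  [1+T]^_ : Adic ℓ → ℤₗ⟦T⟧.Carrier
  [1+T]^ b = binomial ℓ ℓ-prime b

  characteristicSeries : ∀ {t} → Voltage ℓ t → ℤₗ⟦T⟧.Carrier
  characteristicSeries α = sum λ j →
    (ℤₗ⟦T⟧.1# ℤₗ⟦T⟧.+ ℤₗ⟦T⟧.1#)
      ℤₗ⟦T⟧.+ (ℤₗ⟦T⟧.- ([1+T]^ α j))
      ℤₗ⟦T⟧.+ (ℤₗ⟦T⟧.- ([1+T]^ (ℤₗ.- α j)))

  -- The invariants are read off from a Weierstrass factorisation, which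
  -- determines μ and the degree of g uniquely.  They are given as a relation
  -- because μ, the least valuation of infinitely many coefficients, is not
  -- computable from α in general.  lam is an integer since it is deg g - 1.
  record HasIwasawaInvariants {t} (α : Voltage ℓ t) (μ : ℕ) (lam : ℤ) : Set where
    field
      g u           : ℤₗ⟦T⟧.Carrier
      deg           : ℕ
      distinguished : IsDistinguished ℓ g deg
      unit          : IsUnit ℓ u
      factorisation : characteristicSeries α ℤₗ⟦T⟧.≈
                        scale (adicRing ℓ) (fromℤ ℓ (+ (ℓ ^ μ))) (g ℤₗ⟦T⟧.* u)
      lam-deg       : lam ≡ + deg ℤ.- 1ℤ

{-# OPTIONS --safe #-}

-- Take ℓ^(n₁+1) loops of voltage 1 and ℓ^n₁ loops of voltage q = ℓ^n₂.  Since
-- 2 - (1+T)^b - (1+T)^(-b) = -((1+T)^b - 1)² (1+T)^(-b), the characteristic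
-- series is ℓ^n₁ · g · u with u = -(1+T)^(-q) and
-- g = ((1+T)^q - 1)² + ℓ T² (1+T)^(q-1).  As ℓ divides the binomial
-- coefficients of q strictly between 0 and q, g ≡ T^(2q) modulo ℓ, and g is monic
-- of degree 2q because q + 1 < 2q; so no preparation theorem is needed.
module Submission where

open import Defs
open import Data.Integer.Base as ℤ using (+_; 1ℤ)
open import Data.Nat.Base using (ℕ; _+_; _*_; _^_; _≤_)
open import Data.Nat.Primality using (Prime)
open import Data.Product.Base using (Σ-syntax; _×_)

open import Algebra.Bundles using (CommutativeRing; Monoid; RawRing)
import Algebra.Definitions as AlgebraDefinitions
import Algebra.Definitions.RawMagma as RawMagmaDefinitions
import Algebra.Definitions.RawMonoid as RawMonoidDefinitions
import Algebra.Properties.Monoid.Sum as MonoidSum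
import Algebra.Properties.Ring as RingProperties
import Algebra.Properties.Semiring.Divisibility as SemiringDivisibility
import Algebra.Solver.Ring.NaturalCoefficients.Default as NaturalCoefficients
open import Data.Fin.Base using (zero; suc; toℕ; splitAt; _↑ˡ_; fromℕ<)
open import Data.Integer.Base using (ℤ; 0ℤ)
import Data.Integer.Divisibility.Signed as ℤ∣
import Data.Integer.Properties as ℤ
open import Data.Integer.Tactic.RingSolver using (solve-∀)
open import Data.Nat.Base
  using (zero; suc; _∸_; _!; _<_; z≤n; s≤s; NonZero; ≢-nonZero; nonTrivial⇒≢1; nonTrivial⇒n>1)
import Data.Nat.Divisibility as ℕ∣
open import Data.Nat.Primality using (euclidsLemma; prime⇒nonZero; prime⇒nonTrivial)
import Data.Nat.Properties as ℕ
open import Data.Product.Base using (_,_)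
open import Data.Sum.Base using (inj₁; inj₂)
open import Data.Sum.Properties using ([,]-map; [,]-∘)
open import Data.Vec.Functional using (Vector; _++_; replicate)
open import Data.Vec.Functional.Properties using (lookup-++ˡ)
open import Function.Base using (_∘_)
open import Relation.Binary.PropositionalEquality
  using (_≡_; refl; sym; trans; cong; cong₂; subst; module ≡-Reasoning)
import Relation.Binary.Reasoning.Setoid as SetoidReasoning
open import Relation.Nullary using (¬_; yes; no; contradiction)

-- Binomial coefficients with integer upper argument.

fallingℤ-head : ∀ z n → fallingℤ (1ℤ ℤ.+ z) (suc n) ≡ (1ℤ ℤ.+ z) ℤ.* fallingℤ z n
fallingℤ-head z zero    = lemma z
  where
  lemma : ∀ z → 1ℤ ℤ.* ((1ℤ ℤ.+ z) ℤ.- 0ℤ) ≡ (1ℤ ℤ.+ z) ℤ.* 1ℤ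
  lemma = solve-∀
fallingℤ-head z (suc n) =
  trans (cong (ℤ._* ((1ℤ ℤ.+ z) ℤ.- (1ℤ ℤ.+ + n))) (fallingℤ-head z n))
        (lemma z (fallingℤ z n) (+ n))
  where
  lemma : ∀ z f m → (1ℤ ℤ.+ z) ℤ.* f ℤ.* ((1ℤ ℤ.+ z) ℤ.- (1ℤ ℤ.+ m))
                  ≡ (1ℤ ℤ.+ z) ℤ.* (f ℤ.* (z ℤ.- m))
  lemma = solve-∀

-- `binomialℤ` is an opaque quotient, known only through its product with `n !`, so identities
-- between its values are proved by clearing this factor.
*-cancelˡ-! : ∀ n {i j} → + (n !) ℤ.* i ≡ + (n !) ℤ.* j → i ≡ j
*-cancelˡ-! n {i} {j} = ℤ.*-cancelˡ-≡ (+ (n !)) i j {{n ℕ.!≢0}}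

binomialℤ-zeroʳ : ∀ z → binomialℤ z 0 ≡ 1ℤ
binomialℤ-zeroʳ z = trans (sym (ℤ.*-identityˡ (binomialℤ z 0))) (binomialℤ-spec z 0)

-- Multiplied by `n !`, both sides become the falling factorial of `1ℤ + z` with `suc n` factors.
-- The identity serves to compare powers of a prime in neighbouring binomial coefficients.
binomialℤ-absorption : ∀ z n → + suc n ℤ.* binomialℤ (1ℤ ℤ.+ z) (suc n)
                             ≡ (1ℤ ℤ.+ z) ℤ.* binomialℤ z n
binomialℤ-absorption z n = *-cancelˡ-! n (begin
  + (n !) ℤ.* (+ suc n ℤ.* b′)    ≡⟨ swap (+ (n !)) (+ suc n) b′ ⟩
  + suc n ℤ.* + (n !) ℤ.* b′      ≡⟨ cong (ℤ._* b′) (ℤ.pos-* (suc n) (n !)) ⟨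
  + (suc n !) ℤ.* b′              ≡⟨ binomialℤ-spec (1ℤ ℤ.+ z) (suc n) ⟩
  fallingℤ (1ℤ ℤ.+ z) (suc n)     ≡⟨ fallingℤ-head z n ⟩
  (1ℤ ℤ.+ z) ℤ.* fallingℤ z n     ≡⟨ cong ((1ℤ ℤ.+ z) ℤ.*_) (binomialℤ-spec z n) ⟨
  (1ℤ ℤ.+ z) ℤ.* (+ (n !) ℤ.* b)  ≡⟨ swap′ (1ℤ ℤ.+ z) (+ (n !)) b ⟩
  + (n !) ℤ.* ((1ℤ ℤ.+ z) ℤ.* b)  ∎)
  where
  open ≡-Reasoning
  b  = binomialℤ z n
  b′ = binomialℤ (1ℤ ℤ.+ z) (suc n)
  swap : ∀ x y z → x ℤ.* (y ℤ.* z) ≡ y ℤ.* x ℤ.* z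
  swap = solve-∀
  swap′ : ∀ x y z → x ℤ.* (y ℤ.* z) ≡ y ℤ.* (x ℤ.* z)
  swap′ = solve-∀

-- Stated for all integers `z`, because negative powers of `1+T` rely on it as well.
binomialℤ-pascal : ∀ z n → binomialℤ (1ℤ ℤ.+ z) (suc n)
                         ≡ binomialℤ z (suc n) ℤ.+ binomialℤ z n
binomialℤ-pascal z n = *-cancelˡ-! (suc n) (begin
  + (suc n !) ℤ.* binomialℤ (1ℤ ℤ.+ z) (suc n)   ≡⟨ binomialℤ-spec (1ℤ ℤ.+ z) (suc n) ⟩
  fallingℤ (1ℤ ℤ.+ z) (suc n)                    ≡⟨ fallingℤ-head z n ⟩
  (1ℤ ℤ.+ z) ℤ.* fallingℤ z n                    ≡⟨ split z (fallingℤ z n) (+ n) ⟩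
  fallingℤ z (suc n) ℤ.+ + suc n ℤ.* fallingℤ z n
    ≡⟨ cong₂ (λ x y → x ℤ.+ + suc n ℤ.* y) (binomialℤ-spec z (suc n)) (binomialℤ-spec z n) ⟨
  + (suc n !) ℤ.* b₁ ℤ.+ + suc n ℤ.* (+ (n !) ℤ.* b₀)
    ≡⟨ cong (λ x → + (suc n !) ℤ.* b₁ ℤ.+ x) (trans
         (cong (ℤ._* b₀) (ℤ.pos-* (suc n) (n !))) (ℤ.*-assoc (+ suc n) (+ (n !)) b₀)) ⟨
  + (suc n !) ℤ.* b₁ ℤ.+ + (suc n !) ℤ.* b₀     ≡⟨ ℤ.*-distribˡ-+ (+ (suc n !)) b₁ b₀ ⟨
  + (suc n !) ℤ.* (b₁ ℤ.+ b₀)                    ∎)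
  where
  open ≡-Reasoning
  b₀ = binomialℤ z n
  b₁ = binomialℤ z (suc n)
  split : ∀ z f m → (1ℤ ℤ.+ z) ℤ.* f ≡ f ℤ.* (z ℤ.- m) ℤ.+ (1ℤ ℤ.+ m) ℤ.* f
  split = solve-∀

n>m⇒binomialℤ≡0 : ∀ {m n} → m < n → binomialℤ (+ m) n ≡ 0ℤ
n>m⇒binomialℤ≡0 {zero}  {suc n} _         = *-cancelˡ-! (suc n) (begin
  + (suc n !) ℤ.* binomialℤ 0ℤ (suc n)  ≡⟨ binomialℤ-spec 0ℤ (suc n) ⟩
  fallingℤ 0ℤ (suc n)                   ≡⟨ fallingℤ-0 n ⟩
  0ℤ                                    ≡⟨ ℤ.*-zeroʳ (+ (suc n !)) ⟨
  + (suc n !) ℤ.* 0ℤ                    ∎)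
  where
  open ≡-Reasoning
  fallingℤ-0 : ∀ n → fallingℤ 0ℤ (suc n) ≡ 0ℤ
  fallingℤ-0 zero    = refl
  fallingℤ-0 (suc n) = cong (ℤ._* (0ℤ ℤ.- + suc n)) (fallingℤ-0 n)
n>m⇒binomialℤ≡0 {suc m} {suc n} (s≤s m<n) = trans (binomialℤ-pascal (+ m) n)
  (cong₂ ℤ._+_ (n>m⇒binomialℤ≡0 (ℕ.m<n⇒m<1+n m<n)) (n>m⇒binomialℤ≡0 m<n))

binomialℤ-diag : ∀ n → binomialℤ (+ n) n ≡ 1ℤ
binomialℤ-diag zero    = binomialℤ-zeroʳ 0ℤ
binomialℤ-diag (suc n) = trans (binomialℤ-pascal (+ n) n)
  (cong₂ ℤ._+_ (n>m⇒binomialℤ≡0 (ℕ.n<1+n n)) (binomialℤ-diag n))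

-- Binomial coefficients divisible by a prime.

module _ {p} (p-prime : Prime p) where

  private
    instance
      p≢0 : NonZero p
      p≢0 = prime⇒nonZero p-prime

  -- Euclid's lemma places one factor `p` in `m`; after cancelling it on both sides the argument
  -- repeats with `e` lowered by one.
  ∤-cancel : ∀ e {m n} → ¬ p ℕ∣.∣ n → p ^ e ℕ∣.∣ m * n → p ^ e ℕ∣.∣ m
  ∤-cancel zero            p∤n _ = ℕ∣.1∣ _
  ∤-cancel (suc e) {m} {n} p∤n h
    with euclidsLemma m n p-prime (ℕ∣.∣-trans (ℕ∣.m∣m*n (p ^ e)) h)
  ... | inj₂ p∣n                  = contradiction p∣n p∤n
  ... | inj₁ (ℕ∣.divides q refl) = subst (p ^ suc e ℕ∣.∣_) (ℕ.*-comm p q)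
    (ℕ∣.*-monoʳ-∣ p (∤-cancel e p∤n (ℕ∣.*-cancelˡ-∣ p (subst (p ^ suc e ℕ∣.∣_) eq h))))
    where
    eq : q * p * n ≡ p * (q * n)
    eq = trans (cong (_* n) (ℕ.*-comm q p)) (ℕ.*-assoc p q n)

  -- By absorption `p ^ e` divides `suc n` times the binomial coefficient. If `p` did not divide the
  -- latter, `p ^ e` would divide `suc n`, which is positive and smaller.
  prime∣binomialℤ : ∀ e m {n} .{{_ : NonZero m}} → p ^ e ℕ∣.∣ m → suc n < p ^ e →
                    + p ℤ∣.∣ binomialℤ (+ m) (suc n)
  prime∣binomialℤ e (suc m) {n} pᵉ∣m n<pᵉ with p ℕ∣.∣? ℤ.∣ binomialℤ (+ suc m) (suc n) ∣
  ... | yes p∣b = ℤ∣.∣ᵤ⇒∣ p∣b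
  ... | no  p∤b = contradiction (ℕ∣.∣⇒≤ (∤-cancel e p∤b pᵉ∣)) (ℕ.<⇒≱ n<pᵉ)
    where
    absorption : suc m * ℤ.∣ binomialℤ (+ m) n ∣ ≡ suc n * ℤ.∣ binomialℤ (+ suc m) (suc n) ∣
    absorption = begin
      suc m * ℤ.∣ binomialℤ (+ m) n ∣                ≡⟨ ℤ.abs-* (+ suc m) (binomialℤ (+ m) n) ⟨
      ℤ.∣ + suc m ℤ.* binomialℤ (+ m) n ∣            ≡⟨ cong ℤ.∣_∣ (binomialℤ-absorption (+ m) n) ⟨
      ℤ.∣ + suc n ℤ.* binomialℤ (+ suc m) (suc n) ∣  ≡⟨ ℤ.abs-* (+ suc n) (binomialℤ (+ suc m) (suc n)) ⟩
      suc n * ℤ.∣ binomialℤ (+ suc m) (suc n) ∣      ∎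
      where open ≡-Reasoning
    pᵉ∣ : p ^ e ℕ∣.∣ suc n * ℤ.∣ binomialℤ (+ suc m) (suc n) ∣
    pᵉ∣ = subst (p ^ e ℕ∣.∣_) absorption (ℕ∣.∣m⇒∣m*n _ pᵉ∣m)

-- The commutative ring of formal power series.

module PowerSeries {c r} (R : CommutativeRing c r) where

  private
    module R = CommutativeRing R
  open RawRing (seriesRing R) using (Carrier; _≈_; 0#; 1#)
    renaming (_+_ to infixl 6 _⊕_; _*_ to infixl 7 _⊛_)
  open AlgebraDefinitions _≈_
  open MonoidSum R.+-monoid using (sum-cong-≋)
  open NaturalCoefficients R.commutativeSemiring using (solve; _:=_; _:+_; _:*_; con)
  open SetoidReasoning R.setoid

  -- Splitting off the first term of the convolution, `(f ⊛ g) (suc n)` unfolds to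
  -- `f 0 * g (suc n) + (tail f ⊛ g) n`. The inductions on the degree rest on this.
  tail : Carrier → Carrier
  tail f n = f (suc n)

  *-cong : Congruent₂ _⊛_
  *-cong f≈f′ g≈g′ n = sum-cong-≋ {suc n} λ i → R.*-cong (f≈f′ (toℕ i)) (g≈g′ (n ∸ toℕ i))

  *-distribʳ-+ : _⊛_ DistributesOverʳ _⊕_
  *-distribʳ-+ h f g zero    = lemma (f 0) (g 0) (h 0)
    where
    lemma : ∀ a b c → (a R.+ b) R.* c R.+ R.0# R.≈ (a R.* c R.+ R.0#) R.+ (b R.* c R.+ R.0#)
    lemma = solve 3 (λ a b c → (a :+ b) :* c :+ con 0 := (a :* c :+ con 0) :+ (b :* c :+ con 0)) R.refl
  *-distribʳ-+ h f g (suc n) = begin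
    (f 0 R.+ g 0) R.* h (suc n) R.+ ((tail f ⊕ tail g) ⊛ h) n
      ≈⟨ R.+-congˡ (*-distribʳ-+ h (tail f) (tail g) n) ⟩
    (f 0 R.+ g 0) R.* h (suc n) R.+ ((tail f ⊛ h) n R.+ (tail g ⊛ h) n)
      ≈⟨ lemma (f 0) (g 0) (h (suc n)) ((tail f ⊛ h) n) ((tail g ⊛ h) n) ⟩
    ((f ⊛ h) ⊕ (g ⊛ h)) (suc n) ∎
    where
    lemma : ∀ a b c x y →
      (a R.+ b) R.* c R.+ (x R.+ y) R.≈ (a R.* c R.+ x) R.+ (b R.* c R.+ y)
    lemma = solve 5 (λ a b c x y → (a :+ b) :* c :+ (x :+ y) := (a :* c :+ x) :+ (b :* c :+ y)) R.refl

  scale-* : ∀ a f g → scale R a f ⊛ g ≈ scale R a (f ⊛ g)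
  scale-* a f g zero    = lemma a (f 0) (g 0)
    where
    lemma : ∀ a b c → a R.* b R.* c R.+ R.0# R.≈ a R.* (b R.* c R.+ R.0#)
    lemma = solve 3 (λ a b c → a :* b :* c :+ con 0 := a :* (b :* c :+ con 0)) R.refl
  scale-* a f g (suc n) = begin
    a R.* f 0 R.* g (suc n) R.+ (scale R a (tail f) ⊛ g) n
      ≈⟨ R.+-congˡ (scale-* a (tail f) g n) ⟩
    a R.* f 0 R.* g (suc n) R.+ a R.* (tail f ⊛ g) n
      ≈⟨ lemma a (f 0) (g (suc n)) ((tail f ⊛ g) n) ⟩
    a R.* (f ⊛ g) (suc n) ∎
    where
    lemma : ∀ a b c x → a R.* b R.* c R.+ a R.* x R.≈ a R.* (b R.* c R.+ x)
    lemma = solve 4 (λ a b c x → a :* b :* c :+ a :* x := a :* (b :* c :+ x)) R.refl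

  -- Splits off the last term of the convolution. Set against the definitional splitting of the
  -- first term, it yields commutativity.
  *-tailʳ : ∀ f g n → (f ⊛ g) (suc n) R.≈ (f ⊛ tail g) n R.+ f (suc n) R.* g 0
  *-tailʳ f g zero    = lemma (f 0) (g 1) (f 1) (g 0)
    where
    lemma : ∀ a b c d → a R.* b R.+ (c R.* d R.+ R.0#) R.≈ (a R.* b R.+ R.0#) R.+ c R.* d
    lemma = solve 4 (λ a b c d → a :* b :+ (c :* d :+ con 0) := (a :* b :+ con 0) :+ c :* d) R.refl
  *-tailʳ f g (suc n) = R.trans (R.+-congˡ (*-tailʳ (tail f) g n)) (R.sym (R.+-assoc _ _ _))

  *-comm : Commutative _⊛_
  *-comm f g zero    = R.+-congʳ (R.*-comm (f 0) (g 0))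
  *-comm f g (suc n) = begin
    f 0 R.* g (suc n) R.+ (tail f ⊛ g) n  ≈⟨ R.+-cong (R.*-comm _ _) (*-comm (tail f) g n) ⟩
    g (suc n) R.* f 0 R.+ (g ⊛ tail f) n  ≈⟨ R.+-comm _ _ ⟩
    (g ⊛ tail f) n R.+ g (suc n) R.* f 0  ≈⟨ *-tailʳ g f n ⟨
    (g ⊛ f) (suc n)                       ∎

  *-assoc : Associative _⊛_
  *-assoc f g h zero    = lemma (f 0) (g 0) (h 0)
    where
    lemma : ∀ a b c → (a R.* b R.+ R.0#) R.* c R.+ R.0# R.≈ a R.* (b R.* c R.+ R.0#) R.+ R.0#
    lemma = solve 3 (λ a b c → (a :* b :+ con 0) :* c :+ con 0 := a :* (b :* c :+ con 0) :+ con 0) R.refl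
  *-assoc f g h (suc n) = begin
    -- The tail of `f ⊛ g` is `f 0` times the tail of `g`, plus `tail f ⊛ g`.
    (f 0 R.* g 0 R.+ R.0#) R.* h (suc n) R.+ ((scale R (f 0) (tail g) ⊕ tail f ⊛ g) ⊛ h) n
      ≈⟨ R.+-congˡ (*-distribʳ-+ h (scale R (f 0) (tail g)) (tail f ⊛ g) n) ⟩
    (f 0 R.* g 0 R.+ R.0#) R.* h (suc n) R.+
      ((scale R (f 0) (tail g) ⊛ h) n R.+ ((tail f ⊛ g) ⊛ h) n)
      ≈⟨ R.+-congˡ (R.+-cong (scale-* (f 0) (tail g) h n) (*-assoc (tail f) g h n)) ⟩
    (f 0 R.* g 0 R.+ R.0#) R.* h (suc n) R.+
      (f 0 R.* (tail g ⊛ h) n R.+ (tail f ⊛ (g ⊛ h)) n)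
      ≈⟨ lemma (f 0) (g 0) (h (suc n)) ((tail g ⊛ h) n) ((tail f ⊛ (g ⊛ h)) n) ⟩
    (f ⊛ (g ⊛ h)) (suc n) ∎
    where
    lemma : ∀ a b c x y → (a R.* b R.+ R.0#) R.* c R.+ (a R.* x R.+ y)
                        R.≈ a R.* (b R.* c R.+ x) R.+ y
    lemma = solve 5 (λ a b c x y → (a :* b :+ con 0) :* c :+ (a :* x :+ y) :=
                                   a :* (b :* c :+ x) :+ y) R.refl

  *-zeroˡ : LeftZero 0# _⊛_
  *-zeroˡ f zero    = R.trans (R.+-identityʳ _) (R.zeroˡ (f 0))
  *-zeroˡ f (suc n) =
    R.trans (R.+-cong (R.zeroˡ (f (suc n))) (*-zeroˡ f n)) (R.+-identityʳ R.0#)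

  *-identityˡ : LeftIdentity 1# _⊛_
  *-identityˡ f zero    = R.trans (R.+-identityʳ _) (R.*-identityˡ (f 0))
  *-identityˡ f (suc n) =
    R.trans (R.+-cong (R.*-identityˡ (f (suc n))) (*-zeroˡ f n)) (R.+-identityʳ (f (suc n)))

  commutativeRing : CommutativeRing c r
  commutativeRing = record
    { isCommutativeRing = record
      { isRing = record
        { +-isAbelianGroup = record
          { isGroup = record
            { isMonoid = record
              { isSemigroup = record
                { isMagma = record
                  { isEquivalence = record
                    { refl  = λ _ → R.refl
                    ; sym   = λ p n → R.sym (p n)
                    ; trans = λ p q n → R.trans (p n) (q n)
                    }
                  ; ∙-cong = λ p q n → R.+-cong (p n) (q n)
                  }
                ; assoc = λ f g h n → R.+-assoc (f n) (g n) (h n)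
                }
              ; identity = (λ f n → R.+-identityˡ (f n)) , (λ f n → R.+-identityʳ (f n))
              }
            ; inverse = (λ f n → R.-‿inverseˡ (f n)) , (λ f n → R.-‿inverseʳ (f n))
            ; ⁻¹-cong = λ p n → R.-‿cong (p n)
            }
          ; comm = λ f g n → R.+-comm (f n) (g n)
          }
        ; *-cong = *-cong
        ; *-assoc = *-assoc
        ; *-identity = *-identityˡ , λ f n → R.trans (*-comm f 1# n) (*-identityˡ f n)
        ; distrib =
            (λ f g h n → R.trans (*-comm f (g ⊕ h) n)
              (R.trans (*-distribʳ-+ f g h n) (R.+-cong (*-comm g f n) (*-comm h f n))))
          , *-distribʳ-+
        }
      ; *-comm = *-comm
      }
    }

-- Sums over concatenated vectors.

module _ {c ℓ} (M : Monoid c ℓ) where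

  private module M = Monoid M
  open MonoidSum M using (sum; sum-cong-≗; sum-replicate)
  open RawMonoidDefinitions M.rawMonoid using () renaming (_×_ to _·_)

  sum-++ : ∀ {m n} (xs : Vector M.Carrier m) (ys : Vector M.Carrier n) →
           sum (xs ++ ys) M.≈ sum xs M.∙ sum ys
  sum-++ {zero}  xs ys = M.sym (M.identityˡ (sum ys))
  sum-++ {suc m} xs ys = begin
    xs zero M.∙ sum ((xs ++ ys) ∘ suc)          ≡⟨ cong (xs zero M.∙_)
                                                     (sum-cong-≗ λ i → [,]-map (splitAt m i)) ⟩
    xs zero M.∙ sum ((xs ∘ suc) ++ ys)          ≈⟨ M.∙-congˡ (sum-++ (xs ∘ suc) ys) ⟩
    xs zero M.∙ (sum (xs ∘ suc) M.∙ sum ys)     ≈⟨ M.assoc _ _ _ ⟨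
    sum xs M.∙ sum ys                           ∎
    where open SetoidReasoning M.setoid

  -- The characteristic series has this shape: one function of the voltage, summed over two constant
  -- blocks.
  sum-∘-replicate-++ : ∀ {a} {A : Set a} (f : A → M.Carrier) m n x y →
    sum (f ∘ (replicate m x ++ replicate n y)) M.≈ (m · f x) M.∙ (n · f y)
  sum-∘-replicate-++ f m n x y = begin
    sum (f ∘ (replicate m x ++ replicate n y))
      ≡⟨ sum-cong-≗ (λ i → [,]-∘ f (splitAt m i)) ⟩
    sum (replicate m (f x) ++ replicate n (f y))
      ≈⟨ sum-++ (replicate m (f x)) (replicate n (f y)) ⟩
    sum (replicate m (f x)) M.∙ sum (replicate n (f y))
      ≈⟨ M.∙-cong (sum-replicate m) (sum-replicate n) ⟩
    (m · f x) M.∙ (n · f y) ∎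
    where open SetoidReasoning M.setoid

-- Identities in commutative rings.

module RingIdentities {c ℓ} (R : CommutativeRing c ℓ) where

  open CommutativeRing R renaming (_+_ to infixl 6 _⊕_; _*_ to infixl 7 _⊛_;
    refl to ≈-refl; sym to ≈-sym; trans to ≈-trans)
  open RingProperties ring
  open NaturalCoefficients commutativeSemiring using (solve; _:=_; _:+_; _:*_; con)
  open SetoidReasoning setoid

  [-a]*[-b]≈ab : ∀ a b → (- a) ⊛ (- b) ≈ a ⊛ b
  [-a]*[-b]≈ab a b = begin
    (- a) ⊛ (- b)  ≈⟨ -‿distribˡ-* a (- b) ⟨
    - (a ⊛ (- b))  ≈⟨ -‿cong (-‿distribʳ-* a b) ⟨
    - (- (a ⊛ b))  ≈⟨ -‿involutive (a ⊛ b) ⟩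
    a ⊛ b          ∎

  -- By `ab = 1` the product `(2 - a - b)a` is `2a - a² - 1`. For `a = (1+T)^q` this turns the
  -- contribution of a loop into a square.
  [2-a-b]a≈-[a-1]² : ∀ {a b} → a ⊛ b ≈ 1# →
    - ((1# ⊕ 1# ⊕ - a ⊕ - b) ⊛ a) ≈ (a ⊕ - 1#) ⊛ (a ⊕ - 1#)
  [2-a-b]a≈-[a-1]² {a} {b} ab≈1 = ≈-sym (+-inverseʳ-unique X D² (begin
    X ⊕ D²                        ≈⟨ +-identityʳ _ ⟨
    -- The zero is replaced by `ab - 1`. The sum then regroups into products, each with a factor of
    -- the form `x - x`.
    X ⊕ D² ⊕ 0#                   ≈⟨ +-congˡ (≈-trans (+-congʳ ab≈1) (-‿inverseʳ 1#)) ⟨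
    X ⊕ D² ⊕ (a ⊛ b ⊕ - 1#)       ≈⟨ expand a b (- a) (- b) (- 1#) ⟩
    (a ⊕ - a) ⊛ a ⊕ (a ⊕ a) ⊛ (1# ⊕ - 1#) ⊕ a ⊛ (b ⊕ - b) ⊕ - 1# ⊛ (1# ⊕ - 1#)
      ≈⟨ +-cong (+-cong (+-cong (*-congʳ (-‿inverseʳ a)) (*-congˡ (-‿inverseʳ 1#)))
           (*-congˡ (-‿inverseʳ b))) (*-congˡ (-‿inverseʳ 1#)) ⟩
    0# ⊛ a ⊕ (a ⊕ a) ⊛ 0# ⊕ a ⊛ 0# ⊕ - 1# ⊛ 0#
      ≈⟨ solve 2 (λ a u → con 0 :* a :+ (a :+ a) :* con 0 :+ a :* con 0 :+ u :* con 0
                       := con 0) ≈-refl a (- 1#) ⟩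
    0# ∎))
    where
    X  = (1# ⊕ 1# ⊕ - a ⊕ - b) ⊛ a
    D² = (a ⊕ - 1#) ⊛ (a ⊕ - 1#)
    -- The negatives of `a`, `b` and 1 become free variables `n`, `m`, `u`, which leaves an identity
    -- of commutative semirings.
    expand : ∀ a b n m u →
      (1# ⊕ 1# ⊕ n ⊕ m) ⊛ a ⊕ (a ⊕ u) ⊛ (a ⊕ u) ⊕ (a ⊛ b ⊕ u) ≈
      (a ⊕ n) ⊛ a ⊕ (a ⊕ a) ⊛ (1# ⊕ u) ⊕ a ⊛ (b ⊕ m) ⊕ u ⊛ (1# ⊕ u)
    expand = solve 5 (λ a b n m u →
      (con 1 :+ con 1 :+ n :+ m) :* a :+ (a :+ u) :* (a :+ u) :+ (a :* b :+ u) :=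
      (a :+ n) :* a :+ (a :+ a) :* (con 1 :+ u) :+ a :* (b :+ m) :+ u :* (con 1 :+ u)) ≈-refl

  -- Keeping `2a` on the left suits the degrees above `q`, where the coefficients of `a = (1+T)^q`
  -- vanish.
  [a-1]²≈a²-2a+1 : ∀ a → (a ⊕ - 1#) ⊛ (a ⊕ - 1#) ⊕ (a ⊕ a) ≈ a ⊛ a ⊕ 1#
  [a-1]²≈a²-2a+1 a = begin
    (a ⊕ - 1#) ⊛ (a ⊕ - 1#) ⊕ (a ⊕ a)          ≈⟨ expand a (- 1#) ⟩
    a ⊛ a ⊕ - 1# ⊛ - 1# ⊕ (a ⊕ a) ⊛ (1# ⊕ - 1#) ≈⟨ +-cong (+-congˡ
                                                     (≈-trans ([-a]*[-b]≈ab 1# 1#) (*-identityʳ 1#)))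
                                                   (≈-trans (*-congˡ (-‿inverseʳ 1#)) (zeroʳ _)) ⟩
    a ⊛ a ⊕ 1# ⊕ 0#                            ≈⟨ +-identityʳ _ ⟩
    a ⊛ a ⊕ 1#                                 ∎
    where
    expand : ∀ a u → (a ⊕ u) ⊛ (a ⊕ u) ⊕ (a ⊕ a) ≈ a ⊛ a ⊕ u ⊛ u ⊕ (a ⊕ a) ⊛ (1# ⊕ u)
    expand = solve 2 (λ a u → (a :+ u) :* (a :+ u) :+ (a :+ a)
                           := a :* a :+ u :* u :+ (a :+ a) :* (con 1 :+ u)) ≈-refl

  -- For `a = (1+T)^q` and `b`, `c` the powers of `1+T` with exponents 1 and -1, the products on the
  -- right are again powers of `1+T`, which bounds their degrees.
  [2-b-c]a≈2a-ab-ac : ∀ a b c →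
    (1# ⊕ 1# ⊕ - b ⊕ - c) ⊛ a ≈ (a ⊕ a) ⊕ - (a ⊛ b) ⊕ - (a ⊛ c)
  [2-b-c]a≈2a-ab-ac a b c = begin
    (1# ⊕ 1# ⊕ - b ⊕ - c) ⊛ a               ≈⟨ expand a (- b) (- c) ⟩
    (a ⊕ a) ⊕ a ⊛ (- b) ⊕ a ⊛ (- c)         ≈⟨ +-cong (+-congˡ (-‿distribʳ-* a b)) (-‿distribʳ-* a c) ⟨
    (a ⊕ a) ⊕ - (a ⊛ b) ⊕ - (a ⊛ c)         ∎
    where
    expand : ∀ a b c → (1# ⊕ 1# ⊕ b ⊕ c) ⊛ a ≈ (a ⊕ a) ⊕ a ⊛ b ⊕ a ⊛ c
    expand = solve 3 (λ a b c → (con 1 :+ con 1 :+ b :+ c) :* a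
                             := (a :+ a) :+ a :* b :+ a :* c) ≈-refl

  -- Provides the Weierstrass factorisation, with `-(ya)` as the polynomial and `-b` as the unit.
  [-ya]*[-b]≈y : ∀ {a b} y → a ⊛ b ≈ 1# → (- (y ⊛ a)) ⊛ (- b) ≈ y
  [-ya]*[-b]≈y {a} {b} y ab≈1 = begin
    (- (y ⊛ a)) ⊛ (- b)  ≈⟨ [-a]*[-b]≈ab (y ⊛ a) b ⟩
    y ⊛ a ⊛ b            ≈⟨ *-assoc y a b ⟩
    y ⊛ (a ⊛ b)          ≈⟨ *-congˡ ab≈1 ⟩
    y ⊛ 1#               ≈⟨ *-identityʳ y ⟩
    y                    ∎

  y≈0⇒x-y≈x : ∀ {x y} → y ≈ 0# → x ⊕ - y ≈ x
  y≈0⇒x-y≈x y≈0 = ≈-trans (+-congˡ (≈-trans (-‿cong y≈0) -0#≈0#)) (+-identityʳ _)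

  y≈0⇒x+d[-y]≈x : ∀ {x y} d → y ≈ 0# → x ⊕ d ⊛ (- y) ≈ x
  y≈0⇒x+d[-y]≈x d y≈0 = ≈-trans (+-congˡ (≈-sym (-‿distribʳ-* d _)))
    (y≈0⇒x-y≈x (≈-trans (*-congˡ y≈0) (zeroʳ d)))

  x,y,z≈0⇒2x-y-z≈0 : ∀ {x y z} → x ≈ 0# → y ≈ 0# → z ≈ 0# → (x ⊕ x) ⊕ - y ⊕ - z ≈ 0#
  x,y,z≈0⇒2x-y-z≈0 x≈0 y≈0 z≈0 = ≈-trans (y≈0⇒x-y≈x z≈0)
    (≈-trans (y≈0⇒x-y≈x y≈0) (≈-trans (+-cong x≈0 x≈0) (+-identityʳ 0#)))

  y≈0⇒x+2y≈x : ∀ {x y} → y ≈ 0# → x ⊕ (y ⊕ y) ≈ x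
  y≈0⇒x+2y≈x y≈0 = ≈-trans (+-congˡ (≈-trans (+-cong y≈0 y≈0) (+-identityʳ 0#))) (+-identityʳ _)

-- Divisibility of power series coefficients.

module _ {c r} (R : CommutativeRing c r) where
  private
    module R = CommutativeRing R
    module S = RawRing (seriesRing R)
  open RawMonoidDefinitions R.+-rawMonoid using (sum)
  open SemiringDivisibility R.semiring using (_∣_; _,_; _∣0; ∣ʳ-respʳ-≈; x∣ʳy⇒x∣ʳzy)

  ∣-+ : ∀ {d x y} → d ∣ x → d ∣ y → d ∣ x R.+ y
  ∣-+ (p , pd≈x) (q , qd≈y) = p R.+ q , R.trans (R.distribʳ _ p q) (R.+-cong pd≈x qd≈y)

  d∣x⇒d∣x+dy : ∀ {d x} → d ∣ x → ∀ y → d ∣ x R.+ d R.* y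
  d∣x⇒d∣x+dy {d} d∣x y = ∣-+ d∣x (y , R.*-comm y d)

  ∣-sum : ∀ {d n} (xs : Vector R.Carrier n) → (∀ i → d ∣ xs i) → d ∣ sum xs
  ∣-sum {d} {zero}  xs d∣xs = d ∣0
  ∣-sum {n = suc n} xs d∣xs = ∣-+ (d∣xs zero) (∣-sum (xs ∘ suc) (d∣xs ∘ suc))

  -- If two indices add up to less than `m + m`, one of them is below `m`; so every term of the
  -- convolution has a factor divisible by `d`.
  ∣-square-coefficient : ∀ {d m} (f : S.Carrier) → (∀ i → i < m → d ∣ f i) →
                         ∀ n → n < m + m → d ∣ (f S.* f) n
  ∣-square-coefficient {d} {m} f d∣f n n<m+m = ∣-sum {n = suc n} _ term
    where
    term : ∀ i → d ∣ f (toℕ i) R.* f (n ∸ toℕ i)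
    term i with toℕ i ℕ.<? m
    ... | yes i<m = ∣ʳ-respʳ-≈ (R.*-comm _ _) (x∣ʳy⇒x∣ʳzy _ (d∣f (toℕ i) i<m))
    ... | no  i≮m = x∣ʳy⇒x∣ʳzy (f (toℕ i)) (d∣f (n ∸ toℕ i) (ℕ.m<n+o⇒m∸n<o n (toℕ i) {{m≢0}}
                      (ℕ.<-≤-trans n<m+m (ℕ.+-monoˡ-≤ m (ℕ.≮⇒≥ i≮m)))))
      where
      m≢0 : NonZero m
      m≢0 = ≢-nonZero λ { refl → ℕ.n≮0 n<m+m }

  -- Isolates an explicit multiple of `d`, so that modulo `d` only `y` counts.
  -[scale-x+y]a : ∀ d x y a i → (S.- ((scale R d x S.+ y) S.* a)) i R.≈
                  (S.- (y S.* a)) i R.+ d R.* (R.- (x S.* a) i)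
  -[scale-x+y]a d x y a i = begin
    R.- ((scale R d x S.+ y) S.* a) i
      ≈⟨ R.-‿cong (PowerSeries.*-distribʳ-+ R a (scale R d x) y i) ⟩
    R.- ((scale R d x S.* a) i R.+ (y S.* a) i)
      ≈⟨ -‿+-comm _ _ ⟨
    R.- (scale R d x S.* a) i R.+ R.- (y S.* a) i
      ≈⟨ R.+-comm _ _ ⟩
    R.- (y S.* a) i R.+ R.- (scale R d x S.* a) i
      ≈⟨ R.+-congˡ (R.-‿cong (PowerSeries.scale-* R d x a i)) ⟩
    R.- (y S.* a) i R.+ R.- (d R.* (x S.* a) i)
      ≈⟨ R.+-congˡ (-‿distribʳ-* d _) ⟩
    R.- (y S.* a) i R.+ d R.* (R.- (x S.* a) i) ∎
    where
    open SetoidReasoning R.setoid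
    open RingProperties R.ring using (-‿+-comm; -‿distribʳ-*)

-- Integer powers of `1+T` over the `ℓ`-adic integers.

module IntegerPowers (ℓ : ℕ) where

  private
    module ℤₗ = CommutativeRing (adicRing ℓ)
  open PowerSeries (adicRing ℓ) using (commutativeRing)
  private
    module S = CommutativeRing commutativeRing

  fromℤ-cong : ∀ {i j} → i ≡ j → fromℤ ℓ i ℤₗ.≈ fromℤ ℓ j
  fromℤ-cong i≡j = ℤₗ.reflexive (cong (fromℤ ℓ) i≡j)

  fromℤ-homo-+ : ∀ i j → fromℤ ℓ (i ℤ.+ j) ℤₗ.≈ fromℤ ℓ i ℤₗ.+ fromℤ ℓ j
  fromℤ-homo-+ i j = mk≈ λ _ → refl-∣ (i ℤ.+ j) (i ℤ.+ j) refl

  fromℤ-homo-* : ∀ i j → fromℤ ℓ (i ℤ.* j) ℤₗ.≈ fromℤ ℓ i ℤₗ.* fromℤ ℓ j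
  fromℤ-homo-* i j = mk≈ λ _ → refl-∣ (i ℤ.* j) (i ℤ.* j) refl

  -- (1+T)ᶻ.
  power : ℤ → S.Carrier
  power z n = fromℤ ℓ (binomialℤ z n)

  power-0 : power 0ℤ S.≈ S.1#
  power-0 zero    = fromℤ-cong (binomialℤ-zeroʳ 0ℤ)
  power-0 (suc n) = fromℤ-cong (n>m⇒binomialℤ≡0 {0} (s≤s z≤n))

  private
    -- Written so that its tail is the series 1: a product with `1+T` then unfolds to the sum of a
    -- series and its shift.
    1+T : S.Carrier
    1+T zero    = ℤₗ.1#
    1+T (suc n) = S.1# n

  -- Pascal's rule, read coefficient by coefficient.
  power-suc : ∀ z → power (1ℤ ℤ.+ z) S.≈ 1+T S.* power z
  power-suc z zero    = begin
    fromℤ ℓ (binomialℤ (1ℤ ℤ.+ z) 0)   ≈⟨ fromℤ-cong (binomialℤ-zeroʳ (1ℤ ℤ.+ z)) ⟩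
    ℤₗ.1#                              ≈⟨ fromℤ-cong (binomialℤ-zeroʳ z) ⟨
    power z 0                          ≈⟨ S.*-identityˡ (power z) 0 ⟨
    (1+T S.* power z) 0                ∎
    where open SetoidReasoning ℤₗ.setoid
  power-suc z (suc n) = begin
    fromℤ ℓ (binomialℤ (1ℤ ℤ.+ z) (suc n))               ≈⟨ fromℤ-cong (binomialℤ-pascal z n) ⟩
    fromℤ ℓ (binomialℤ z (suc n) ℤ.+ binomialℤ z n)
      ≈⟨ fromℤ-homo-+ (binomialℤ z (suc n)) (binomialℤ z n) ⟩
    power z (suc n) ℤₗ.+ power z n
      ≈⟨ ℤₗ.+-cong (ℤₗ.*-identityˡ (power z (suc n))) (S.*-identityˡ (power z) n) ⟨
    (1+T S.* power z) (suc n) ∎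
    where open SetoidReasoning ℤₗ.setoid

  -- The induction runs on the natural exponent `m`. An arbitrary integer `z` is allowed in order to
  -- cover inverses and the exponent `q - 1`.
  power-homo-+ : ∀ m z → power (+ m ℤ.+ z) S.≈ power (+ m) S.* power z
  power-homo-+ zero    z = begin
    power (0ℤ ℤ.+ z)        ≡⟨ cong power (ℤ.+-identityˡ z) ⟩
    power z                 ≈⟨ S.*-identityˡ (power z) ⟨
    S.1# S.* power z        ≈⟨ S.*-congʳ {power z} {power 0ℤ} {S.1#} power-0 ⟨
    power 0ℤ S.* power z    ∎
    where open SetoidReasoning S.setoid
  power-homo-+ (suc m) z = begin
    power (+ suc m ℤ.+ z)             ≡⟨ cong power (ℤ.+-assoc 1ℤ (+ m) z) ⟩
    power (1ℤ ℤ.+ (+ m ℤ.+ z))        ≈⟨ power-suc (+ m ℤ.+ z) ⟩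
    1+T S.* power (+ m ℤ.+ z)
      ≈⟨ S.*-congˡ {1+T} {power (+ m ℤ.+ z)} {power (+ m) S.* power z} (power-homo-+ m z) ⟩
    1+T S.* (power (+ m) S.* power z) ≈⟨ S.*-assoc 1+T (power (+ m)) (power z) ⟨
    1+T S.* power (+ m) S.* power z
      ≈⟨ S.*-congʳ {power z} {power (+ suc m)} {1+T S.* power (+ m)} (power-suc (+ m)) ⟨
    power (+ suc m) S.* power z       ∎
    where open SetoidReasoning S.setoid

  n>m⇒power≈0 : ∀ {m n} → m < n → power (+ m) n ℤₗ.≈ ℤₗ.0#
  n>m⇒power≈0 m<n = fromℤ-cong (n>m⇒binomialℤ≡0 m<n)

  power-inverse : ∀ m → power (+ m) S.* power (ℤ.- + m) S.≈ S.1#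
  power-inverse m = begin
    power (+ m) S.* power (ℤ.- + m)  ≈⟨ power-homo-+ m (ℤ.- + m) ⟨
    power (+ m ℤ.- + m)              ≡⟨ cong power (ℤ.+-inverseʳ (+ m)) ⟩
    power 0ℤ                         ≈⟨ power-0 ⟩
    S.1#                             ∎
    where open SetoidReasoning S.setoid

  loop : ℤ → S.Carrier
  loop z = (S.1# S.+ S.1#) S.+ (S.- power z) S.+ (S.- power (ℤ.- z))

  open RawMonoidDefinitions S.+-rawMonoid using () renaming (_×_ to _·_)

  ·≈scale : ∀ n f → n · f S.≈ scale (adicRing ℓ) (fromℤ ℓ (+ n)) f
  ·≈scale zero    f i = ℤₗ.sym (ℤₗ.zeroˡ (f i))
  ·≈scale (suc n) f i = begin
    f i ℤₗ.+ (n · f) i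
      ≈⟨ ℤₗ.+-cong {f i} {ℤₗ.1# ℤₗ.* f i} {(n · f) i} {fromℤ ℓ (+ n) ℤₗ.* f i}
           (ℤₗ.sym (ℤₗ.*-identityˡ (f i))) (·≈scale n f i) ⟩
    ℤₗ.1# ℤₗ.* f i ℤₗ.+ fromℤ ℓ (+ n) ℤₗ.* f i  ≈⟨ ℤₗ.distribʳ (f i) ℤₗ.1# (fromℤ ℓ (+ n)) ⟨
    (ℤₗ.1# ℤₗ.+ fromℤ ℓ (+ n)) ℤₗ.* f i        ≈⟨ ℤₗ.*-congʳ {f i} (fromℤ-homo-+ 1ℤ (+ n)) ⟨
    fromℤ ℓ (+ suc n) ℤₗ.* f i               ∎
    where open SetoidReasoning ℤₗ.setoid

-- Characteristic series of integer voltages.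

module _ (ℓ : ℕ) (ℓ-prime : Prime ℓ) where

  private
    module ℤₗ where
      open CommutativeRing (adicRing ℓ) public
      open RingIdentities (adicRing ℓ) public
    module S where
      open CommutativeRing (PowerSeries.commutativeRing (adicRing ℓ)) public
      open RingIdentities (PowerSeries.commutativeRing (adicRing ℓ)) public
    instance
      ℓ≢0 : NonZero ℓ
      ℓ≢0 = prime⇒nonZero ℓ-prime
  open RawMagmaDefinitions ℤₗ.*-rawMagma using () renaming (_∣_ to _∣ₐ_; _,_ to _,ₐ_)
  open RawMonoidDefinitions S.+-rawMonoid using () renaming (_×_ to _·_)
  open SemiringDivisibility ℤₗ.semiring using (∣ʳ-respʳ-≈)
  open IntegerPowers ℓ

  -- Already modulo `ℓ`, an equation `cℓ = 1` would make `ℓ` divide 1 in the integers.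
  ℓ∤1 : ¬ (fromℤ ℓ (+ ℓ) ∣ₐ ℤₗ.1#)
  ℓ∤1 (c ,ₐ cℓ≈1) = nonTrivial⇒≢1 {{prime⇒nonTrivial ℓ-prime}}
    (ℕ∣.∣1⇒≡1 (ℤ∣.∣⇒∣ᵤ (ℤ∣.∣m+n∣m⇒∣n {m = approx c 1 ℤ.* + ℓ} {n = ℤ.- 1ℤ}
      (subst (λ m → + m ℤ∣.∣ approx c 1 ℤ.* + ℓ ℤ.- 1ℤ) (ℕ.*-identityʳ ℓ) (residue cℓ≈1 1))
      (ℤ∣.divides (approx c 1) refl))))

  -- Requiring `b` to be a constant sequence covers both `fromℤ ℓ z` and its negative, and makes the
  -- index shift by `n !` in `binomial` harmless.
  binomial≈power : ∀ b z → (∀ k → approx b k ≡ z) → ∀ n → binomial ℓ ℓ-prime b n ℤₗ.≈ power z n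
  binomial≈power b z b≡z n = mk≈ λ k → refl-∣ (approx (binomial ℓ ℓ-prime b n) k) (binomialℤ z n)
    (cong (λ i → binomialℤ i n) (b≡z (n ! + k)))

  characteristicSeries-replicate-++ : ∀ m n w z k →
    characteristicSeries ℓ ℓ-prime (replicate m (fromℤ ℓ w) ++ replicate n (fromℤ ℓ z)) k ℤₗ.≈
    fromℤ ℓ (+ m) ℤₗ.* loop w k ℤₗ.+ fromℤ ℓ (+ n) ℤₗ.* loop z k
  characteristicSeries-replicate-++ m n w z k = ℤₗ.trans
    {characteristicSeries ℓ ℓ-prime (replicate m (fromℤ ℓ w) ++ replicate n (fromℤ ℓ z)) k}
    {(m · summand (fromℤ ℓ w)) k ℤₗ.+ (n · summand (fromℤ ℓ z)) k}
    {fromℤ ℓ (+ m) ℤₗ.* loop w k ℤₗ.+ fromℤ ℓ (+ n) ℤₗ.* loop z k}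
    (sum-∘-replicate-++ S.+-monoid summand m n (fromℤ ℓ w) (fromℤ ℓ z) k)
    (ℤₗ.+-cong {(m · summand (fromℤ ℓ w)) k} {fromℤ ℓ (+ m) ℤₗ.* loop w k}
               {(n · summand (fromℤ ℓ z)) k} {fromℤ ℓ (+ n) ℤₗ.* loop z k}
               (multiple m w) (multiple n z))
    where
    summand : Adic ℓ → S.Carrier
    summand b = (S.1# S.+ S.1#) S.+ (S.- ([1+T]^_ ℓ ℓ-prime b))
                  S.+ (S.- ([1+T]^_ ℓ ℓ-prime (ℤₗ.- b)))
    summand≈loop : ∀ z → summand (fromℤ ℓ z) S.≈ loop z
    summand≈loop z = S.+-cong
      {(S.1# S.+ S.1#) S.+ (S.- ([1+T]^_ ℓ ℓ-prime (fromℤ ℓ z)))}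
      {(S.1# S.+ S.1#) S.+ (S.- power z)}
      {S.- ([1+T]^_ ℓ ℓ-prime (ℤₗ.- fromℤ ℓ z))}
      {S.- power (ℤ.- z)}
      (S.+-congˡ {S.1# S.+ S.1#} {S.- ([1+T]^_ ℓ ℓ-prime (fromℤ ℓ z))} {S.- power z}
        (S.-‿cong {[1+T]^_ ℓ ℓ-prime (fromℤ ℓ z)} {power z}
          (binomial≈power (fromℤ ℓ z) z (λ _ → refl))))
      (S.-‿cong {[1+T]^_ ℓ ℓ-prime (ℤₗ.- fromℤ ℓ z)} {power (ℤ.- z)}
        (binomial≈power (ℤₗ.- fromℤ ℓ z) (ℤ.- z) (λ _ → refl)))
    multiple : ∀ m z → (m · summand (fromℤ ℓ z)) k ℤₗ.≈ fromℤ ℓ (+ m) ℤₗ.* loop z k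
    multiple m z = ℤₗ.trans {(m · summand (fromℤ ℓ z)) k}
      {fromℤ ℓ (+ m) ℤₗ.* summand (fromℤ ℓ z) k} {fromℤ ℓ (+ m) ℤₗ.* loop z k}
      (·≈scale m (summand (fromℤ ℓ z)) k)
      (ℤₗ.*-congˡ {fromℤ ℓ (+ m)} {summand (fromℤ ℓ z) k} {loop z k} (summand≈loop z k))

  -- The chosen voltages and their Weierstrass factorisation.

  module _ (n₁ n₂ : ℕ) where

    q : ℕ
    q = ℓ ^ n₂

    -- The first block is nonempty and consists of ones, which `ℓ` does not divide.
    admissible : Admissible ℓ
      (replicate (ℓ ^ (n₁ + 1)) (fromℤ ℓ 1ℤ) ++ replicate (ℓ ^ n₁) (fromℤ ℓ (+ q)))
    admissible ℓ∣α = ℓ∤1 (subst (fromℤ ℓ (+ ℓ) ∣ₐ_)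
      (lookup-++ˡ (replicate (ℓ ^ (n₁ + 1)) (fromℤ ℓ 1ℤ)) (replicate (ℓ ^ n₁) (fromℤ ℓ (+ q))) j)
      (ℓ∣α (j ↑ˡ ℓ ^ n₁)))
      where j = fromℕ< (ℕ.m^n>0 ℓ (n₁ + 1))

    -- The characteristic series with its factor `ℓ ^ n₁` removed.
    y : S.Carrier
    y = scale (adicRing ℓ) (fromℤ ℓ (+ ℓ)) (loop 1ℤ) S.+ loop (+ q)

    characteristicSeries≈ :
      characteristicSeries ℓ ℓ-prime
        (replicate (ℓ ^ (n₁ + 1)) (fromℤ ℓ 1ℤ) ++ replicate (ℓ ^ n₁) (fromℤ ℓ (+ q))) S.≈
      scale (adicRing ℓ) (fromℤ ℓ (+ (ℓ ^ n₁))) y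
    characteristicSeries≈ k = ℤₗ.trans
      {characteristicSeries ℓ ℓ-prime
        (replicate (ℓ ^ (n₁ + 1)) (fromℤ ℓ 1ℤ) ++ replicate (ℓ ^ n₁) (fromℤ ℓ (+ q))) k}
      {fromℤ ℓ (+ (ℓ ^ (n₁ + 1))) ℤₗ.* x₁ ℤₗ.+ L ℤₗ.* x_q}
      {L ℤₗ.* (fromℤ ℓ (+ ℓ) ℤₗ.* x₁ ℤₗ.+ x_q)}
      (characteristicSeries-replicate-++ (ℓ ^ (n₁ + 1)) (ℓ ^ n₁) 1ℤ (+ q) k)
      (factor x₁ x_q)
      where
      x₁  = loop 1ℤ k
      x_q = loop (+ q) k
      L   = fromℤ ℓ (+ (ℓ ^ n₁))
      ℓ^[n₁+1] : fromℤ ℓ (+ (ℓ ^ (n₁ + 1))) ℤₗ.≈ L ℤₗ.* fromℤ ℓ (+ ℓ)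
      ℓ^[n₁+1] = ℤₗ.trans
        (fromℤ-cong (trans (cong +_ (trans (ℕ.^-distribˡ-+-* ℓ n₁ 1)
                                           (cong (ℓ ^ n₁ *_) (ℕ.*-identityʳ ℓ))))
                           (ℤ.pos-* (ℓ ^ n₁) ℓ)))
        (fromℤ-homo-* (+ (ℓ ^ n₁)) (+ ℓ))
      factor : ∀ b c → fromℤ ℓ (+ (ℓ ^ (n₁ + 1))) ℤₗ.* b ℤₗ.+ L ℤₗ.* c ℤₗ.≈
                       L ℤₗ.* (fromℤ ℓ (+ ℓ) ℤₗ.* b ℤₗ.+ c)
      factor b c = begin
        fromℤ ℓ (+ (ℓ ^ (n₁ + 1))) ℤₗ.* b ℤₗ.+ L ℤₗ.* c
          ≈⟨ ℤₗ.+-congʳ {L ℤₗ.* c}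
               (ℤₗ.trans (ℤₗ.*-congʳ {b} ℓ^[n₁+1]) (ℤₗ.*-assoc L (fromℤ ℓ (+ ℓ)) b)) ⟩
        L ℤₗ.* (fromℤ ℓ (+ ℓ) ℤₗ.* b) ℤₗ.+ L ℤₗ.* c
          ≈⟨ ℤₗ.distribˡ L (fromℤ ℓ (+ ℓ) ℤₗ.* b) c ⟨
        L ℤₗ.* (fromℤ ℓ (+ ℓ) ℤₗ.* b ℤₗ.+ c) ∎
        where open SetoidReasoning ℤₗ.setoid

    private
      -- Multiplication by `a = (1+T)^q` clears the negative powers of `1+T` in `y`, so that `g` is
      -- a polynomial; `u` undoes the multiplication and the sign.
      a a⁻¹ g u : S.Carrier
      a   = power (+ q)
      a⁻¹ = power (ℤ.- + q)
      g   = S.- (y S.* a)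
      u   = S.- a⁻¹

      [a-1]² : S.Carrier
      [a-1]² = (a S.+ S.- S.1#) S.* (a S.+ S.- S.1#)

    -- The loops of voltage `q` give the square, those of voltage 1 the multiple of `ℓ`. Of the
    -- latter only its divisibility and a bound on its degree matter, so it is not expanded to
    -- `T²(1+T)^(q-1)`.
    g-coefficient : ∀ i → g i ℤₗ.≈
      [a-1]² i ℤₗ.+ fromℤ ℓ (+ ℓ) ℤₗ.* (ℤₗ.- (loop 1ℤ S.* a) i)
    g-coefficient i = ℤₗ.trans {g i}
      {(S.- (loop (+ q) S.* a)) i ℤₗ.+ fromℤ ℓ (+ ℓ) ℤₗ.* (ℤₗ.- (loop 1ℤ S.* a) i)}
      {[a-1]² i ℤₗ.+ fromℤ ℓ (+ ℓ) ℤₗ.* (ℤₗ.- (loop 1ℤ S.* a) i)}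
      (-[scale-x+y]a (adicRing ℓ) (fromℤ ℓ (+ ℓ)) (loop 1ℤ) (loop (+ q)) a i)
      (ℤₗ.+-congʳ {fromℤ ℓ (+ ℓ) ℤₗ.* (ℤₗ.- (loop 1ℤ S.* a) i)}
        {(S.- (loop (+ q) S.* a)) i} {[a-1]² i}
        (S.[2-a-b]a≈-[a-1]² {a} {a⁻¹} (power-inverse q) i))

    -- The product is `2(1+T)^q - (1+T)^(q+1) - (1+T)^(q-1)`, a polynomial of degree at most
    -- `q + 1`.
    loop-1*a≈0 : ∀ {i} → suc q < i → (loop 1ℤ S.* a) i ℤₗ.≈ ℤₗ.0#
    loop-1*a≈0 {i} q+1<i = ℤₗ.trans {(loop 1ℤ S.* a) i}
      {(a i ℤₗ.+ a i) ℤₗ.+ ℤₗ.- (a S.* power 1ℤ) i ℤₗ.+ ℤₗ.- (a S.* power (ℤ.- 1ℤ)) i}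
      {ℤₗ.0#}
      (S.[2-b-c]a≈2a-ab-ac a (power 1ℤ) (power (ℤ.- 1ℤ)) i)
      (ℤₗ.x,y,z≈0⇒2x-y-z≈0 {a i} {(a S.* power 1ℤ) i} {(a S.* power (ℤ.- 1ℤ)) i} a≈0 a*b≈0 a*c≈0)
      where
      a≈0 : a i ℤₗ.≈ ℤₗ.0#
      a≈0 = n>m⇒power≈0 (ℕ.<-trans (ℕ.n<1+n q) q+1<i)
      a*b≈0 : (a S.* power 1ℤ) i ℤₗ.≈ ℤₗ.0#
      a*b≈0 = ℤₗ.trans (ℤₗ.sym (power-homo-+ q 1ℤ i))
        (n>m⇒power≈0 (subst (_< i) (ℕ.+-comm 1 q) q+1<i))
      a*c≈0 : (a S.* power (ℤ.- 1ℤ)) i ℤₗ.≈ ℤₗ.0#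
      a*c≈0 = ℤₗ.trans (ℤₗ.sym (power-homo-+ q (ℤ.- 1ℤ) i)) (ℤₗ.trans
        (fromℤ-cong (cong (λ z → binomialℤ z i)
          -- As `q` is positive, the exponent `q - 1` is a natural number and the power is a
          -- polynomial.
          (trans (ℤ.m-n≡m⊖n q 1) (ℤ.⊖-≥ (ℕ.m^n>0 ℓ n₂)))))
        (n>m⇒power≈0 (ℕ.≤-<-trans (ℕ.m∸n≤m q 1) (ℕ.<-trans (ℕ.n<1+n q) q+1<i))))

    [a-1]²-upper : ∀ {i} → q < i → [a-1]² i ℤₗ.≈ power (+ (q + q)) i
    -- An index above `q` is positive, so the summand 1 of `a² + 1` contributes 0.
    [a-1]²-upper {suc i} q<i = begin
      [a-1]² (suc i)                                 ≈⟨ ℤₗ.y≈0⇒x+2y≈x {[a-1]² (suc i)} {a (suc i)}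
                                                          (n>m⇒power≈0 q<i) ⟨
      [a-1]² (suc i) ℤₗ.+ (a (suc i) ℤₗ.+ a (suc i)) ≈⟨ S.[a-1]²≈a²-2a+1 a (suc i) ⟩
      (a S.* a) (suc i) ℤₗ.+ ℤₗ.0#                   ≈⟨ ℤₗ.+-identityʳ ((a S.* a) (suc i)) ⟩
      (a S.* a) (suc i)                              ≈⟨ power-homo-+ q (+ q) (suc i) ⟨
      power (+ (q + q)) (suc i)                      ∎
      where open SetoidReasoning ℤₗ.setoid

    -- The constant terms cancel; the remaining coefficients are binomial coefficients of the prime
    -- power `q` strictly between its two ends.
    [a-1]-lower : ∀ i → i < q → fromℤ ℓ (+ ℓ) ∣ₐ (a S.+ S.- S.1#) i
    [a-1]-lower zero    _   = ℤₗ.0# ,ₐ ℤₗ.trans (ℤₗ.zeroˡ (fromℤ ℓ (+ ℓ))) (ℤₗ.sym (ℤₗ.trans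
      (ℤₗ.+-congʳ {ℤₗ.- ℤₗ.1#} (fromℤ-cong (binomialℤ-zeroʳ (+ q)))) (ℤₗ.-‿inverseʳ ℤₗ.1#)))
    [a-1]-lower (suc i) i<q with prime∣binomialℤ ℓ-prime n₂ q {{ℕ.m^n≢0 ℓ n₂}} ℕ∣.∣-refl i<q
    ... | ℤ∣.divides c b≡cℓ = fromℤ ℓ c ,ₐ ℤₗ.trans (ℤₗ.sym (fromℤ-homo-* c (+ ℓ)))
      (ℤₗ.trans (fromℤ-cong (sym b≡cℓ)) (ℤₗ.sym
        (ℤₗ.y≈0⇒x-y≈x {a (suc i)} {ℤₗ.0#} ℤₗ.refl)))

    module _ (1≤n₂ : 1 ≤ n₂) where

      -- `1 ≤ n₂` gives `q ≥ ℓ > 1`. Hence the multiple of `ℓ` in `g`, of degree at most `q + 1`,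
      -- stays below the leading term.
      1+q<q+q : suc q < q + q
      1+q<q+q = ℕ.+-monoˡ-< q (ℕ.<-≤-trans (nonTrivial⇒n>1 ℓ {{prime⇒nonTrivial ℓ-prime}})
        (subst (_≤ q) (ℕ.*-identityʳ ℓ) (ℕ.^-monoʳ-≤ ℓ 1≤n₂)))

      -- From degree `2q` on only `(1+T)^(2q)` survives, which yields both the leading coefficient 1
      -- and the vanishing above it.
      g-upper : ∀ i → q + q ≤ i → g i ℤₗ.≈ power (+ (q + q)) i
      g-upper i 2q≤i = begin
        g i                                                        ≈⟨ g-coefficient i ⟩
        [a-1]² i ℤₗ.+ fromℤ ℓ (+ ℓ) ℤₗ.* (ℤₗ.- (loop 1ℤ S.* a) i)
          ≈⟨ ℤₗ.y≈0⇒x+d[-y]≈x {[a-1]² i} {(loop 1ℤ S.* a) i} (fromℤ ℓ (+ ℓ)) (loop-1*a≈0 1+q<i) ⟩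
        [a-1]² i             ≈⟨ [a-1]²-upper (ℕ.<-trans (ℕ.n<1+n q) 1+q<i) ⟩
        power (+ (q + q)) i  ∎
        where
        open SetoidReasoning ℤₗ.setoid
        1+q<i = ℕ.<-≤-trans 1+q<q+q 2q≤i

      g-distinguished : IsDistinguished ℓ g (q + q)
      g-distinguished = record
        { monic  = ℤₗ.trans (g-upper (q + q) ℕ.≤-refl) (fromℤ-cong (binomialℤ-diag (q + q)))
        ; lower  = λ i i<2q → ∣ʳ-respʳ-≈ (ℤₗ.sym (g-coefficient i)) (d∣x⇒d∣x+dy (adicRing ℓ)
            {fromℤ ℓ (+ ℓ)} {[a-1]² i}
            (∣-square-coefficient (adicRing ℓ) (a S.+ S.- S.1#) [a-1]-lower i i<2q)
            (ℤₗ.- (loop 1ℤ S.* a) i))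
        ; degree = λ i 2q<i → ℤₗ.trans (g-upper i (ℕ.<⇒≤ 2q<i)) (n>m⇒power≈0 2q<i)
        }

      hasIwasawaInvariants :
        HasIwasawaInvariants ℓ ℓ-prime
          (replicate (ℓ ^ (n₁ + 1)) (fromℤ ℓ 1ℤ) ++ replicate (ℓ ^ n₁) (fromℤ ℓ (+ q)))
          n₁ (+ (2 * q) ℤ.- 1ℤ)
      hasIwasawaInvariants = record
        { g = g
        ; u = u
        ; deg = q + q
        ; distinguished = g-distinguished
        ; unit = S.- a
               , S.trans {(S.- a) S.* u} {a S.* a⁻¹} {S.1#} (S.[-a]*[-b]≈ab a a⁻¹) (power-inverse q)
               , S.trans {u S.* (S.- a)} {a⁻¹ S.* a} {S.1#} (S.[-a]*[-b]≈ab a⁻¹ a)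
                   (S.trans {a⁻¹ S.* a} {a S.* a⁻¹} {S.1#} (S.*-comm a⁻¹ a) (power-inverse q))
        ; factorisation = λ k → ℤₗ.trans (characteristicSeries≈ k)
            (ℤₗ.*-congˡ {fromℤ ℓ (+ (ℓ ^ n₁))}
              (ℤₗ.sym (S.[-ya]*[-b]≈y {a} {a⁻¹} y (power-inverse q) k)))
        -- `2 * q` unfolds to `q + (q + 0)`.
        ; lam-deg = cong (λ m → + (q + m) ℤ.- 1ℤ) (ℕ.+-identityʳ q)
        }

lemma2p17 : (n₁ n₂ : ℕ) → 1 ≤ n₂ → (ℓ : ℕ) (ℓ-prime : Prime ℓ) →
    let t = ℓ ^ (n₁ + 1) + ℓ ^ n₁ in
    Σ[ α ∈ Voltage ℓ t ]
    (Admissible ℓ α ×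
    HasIwasawaInvariants ℓ ℓ-prime α n₁ (+ (2 * ℓ ^ n₂) ℤ.- 1ℤ))
lemma2p17 n₁ n₂ 1≤n₂ ℓ ℓ-prime =
  -- The vector is inferred from the type of `admissible`: `ℓ ^ (n₁ + 1)` entries 1 followed by
  -- `ℓ ^ n₁` entries `ℓ ^ n₂`.
  _ , admissible ℓ ℓ-prime n₁ n₂ , hasIwasawaInvariants ℓ ℓ-prime n₁ n₂ 1≤n₂
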